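{- The Clebsch graph (the 5-regular graph on 16 vertices and 40 edges, also known as the Greenwood–Gleason graph) is not word-representable.
   Context: Graphs are finite, simple and undirected. Two distinct letters $x$ and $y$ alternate in a word $w$ if after deleting from $w$ all letters except the copies of $x$ and $y$ one obtains either a word $xyxy\cdots$ (of even or odd length) or a word $yxyx\cdots$ (of even or odd length). A graph $G=(V,E)$ is word-representable if there exists a (finite) word $w$ over the alphabet $V$, in which each letter of $V$ occurs at least once, such that for all distinct $x,y\in V$, the letters $x$ and $y$ alternate in $w$ if and only if $xy\in E$. The Clebsch graph is the graph with vertex set $\{1,2,\ldots,16\}$ and the following 40 edges (written $a$-$b$): 1-4, 3-6, 5-8, 7-10, 9-12, 11-14, 13-16, 2-15; 2-3, 4-5, 6-7, 8-9, 10-11, 12-13, 14-15, 1-16; 2-4, 4-6, 6-8, 8-10, 10-12, 12-14, 14-16, 2-16; 2-10, 4-12, 6-14, 8-16, 1-9, 3-11, 5-13, 7-15; 1-7, 3-9, 5-11, 7-13, 9-15, 1-11, 3-13, 5-15. -}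

module Defs where

open import Data.Fin.Base using (Fin; toℕ)
open import Data.Fin.Properties using (_≟_; all?)
open import Data.List.Base using (List; []; _∷_; filter; length; allFin)
open import Data.List.Membership.Propositional using (_∈_)
import Data.List.Membership.DecPropositional as DecMembership
open import Data.Nat.Base using (ℕ; zero; suc)
import Data.Nat.Properties as ℕ
open import Data.Product.Base using (_×_; _,_; ∃-syntax)
open import Data.Product.Properties using (≡-dec)
open import Data.Sum.Base using (_⊎_; swap)
open import Function.Bundles using (_⇔_)
open import Level using (0ℓ)
open import Relation.Binary.Core using (Rel)
open import Relation.Binary.Definitions using (Symmetric; Decidable)
open import Relation.Binary.PropositionalEquality using (_≡_; _≢_; refl)
open import Relation.Nullary using (¬_)
open import Relation.Nullary.Decidable using (_⊎-dec_; ¬?; toWitness)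

record Graph : Set₁ where
  field
    order  : ℕ
  Vertex : Set
  Vertex = Fin order
  field
    Edge   : Rel Vertex 0ℓ
    sym    : Symmetric Edge
    irrefl : ∀ x → ¬ Edge x x

module _ {n : ℕ} where

  restrict : Fin n → Fin n → List (Fin n) → List (Fin n)
  restrict x y = filter (λ z → (z ≟ x) ⊎-dec (z ≟ y))

  -- The word xyxy⋯ of length k.
  alternating : Fin n → Fin n → ℕ → List (Fin n)
  alternating x y zero    = []
  alternating x y (suc k) = x ∷ alternating y x k

  -- Used only for x ≢ y.
  Alternate : Fin n → Fin n → List (Fin n) → Set
  Alternate x y w =
    ∃[ k ] (restrict x y w ≡ alternating x y k ⊎ restrict x y w ≡ alternating y x k)

Represents : (G : Graph) → List (Graph.Vertex G) → Set
Represents G w =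
  (∀ x → x ∈ w) × (∀ x y → x ≢ y → Alternate x y w ⇔ Edge x y)
  where open Graph G

WordRepresentable : Graph → Set
WordRepresentable G = ∃[ w ] Represents G w

clebschEdges : List (ℕ × ℕ)
clebschEdges =
  (1 , 4)  ∷ (3 , 6)  ∷ (5 , 8)  ∷ (7 , 10) ∷ (9 , 12)  ∷ (11 , 14) ∷ (13 , 16) ∷ (2 , 15) ∷
  (2 , 3)  ∷ (4 , 5)  ∷ (6 , 7)  ∷ (8 , 9)  ∷ (10 , 11) ∷ (12 , 13) ∷ (14 , 15) ∷ (1 , 16) ∷
  (2 , 4)  ∷ (4 , 6)  ∷ (6 , 8)  ∷ (8 , 10) ∷ (10 , 12) ∷ (12 , 14) ∷ (14 , 16) ∷ (2 , 16) ∷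
  (2 , 10) ∷ (4 , 12) ∷ (6 , 14) ∷ (8 , 16) ∷ (1 , 9)   ∷ (3 , 11)  ∷ (5 , 13)  ∷ (7 , 15) ∷
  (1 , 7)  ∷ (3 , 9)  ∷ (5 , 11) ∷ (7 , 13) ∷ (9 , 15)  ∷ (1 , 11)  ∷ (3 , 13)  ∷ (5 , 15) ∷ []

-- The element i of Fin 16 stands for the vertex with label i + 1.
label : Fin 16 → ℕ
label i = suc (toℕ i)

ClebschEdge : Rel (Fin 16) 0ℓ
ClebschEdge x y = (label x , label y) ∈ clebschEdges ⊎ (label y , label x) ∈ clebschEdges

clebschEdge? : Decidable ClebschEdge
clebschEdge? x y =
  ((label x , label y) ∈? clebschEdges) ⊎-dec ((label y , label x) ∈? clebschEdges)
  where open DecMembership (≡-dec ℕ._≟_ ℕ._≟_) using (_∈?_)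

clebsch : Graph
clebsch = record
  { order  = 16
  ; Edge   = ClebschEdge
  ; sym    = swap
  ; irrefl = toWitness {a? = all? (λ x → ¬? (clebschEdge? x x))} _
  }

clebsch-size : length clebschEdges ≡ 40
clebsch-size = refl

clebsch-5-regular : ∀ x → length (filter (clebschEdge? x) (allFin 16)) ≡ 5
clebsch-5-regular =
  toWitness {a? = all? (λ x → length (filter (clebschEdge? x) (allFin 16)) ℕ.≟ 5)} _

{-# OPTIONS --safe #-}

-- Suppose w represents G, and orient every edge from the endpoint that occurs first in w to the
-- other one.  If x → y, then in every prefix of w the number of x's is the number of y's or one
-- more.  Hence a 4-cycle with three consecutive edges oriented a → b → c → d has the chord ac,
-- because the number of a's is then squeezed between that of c's and one more.  So every chordless
-- 4-cycle has exactly two edges in each direction; equivalently, replacing a - b - c in a walk by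
-- a - d - c preserves the number of edges traversed forwards.
--
-- The Clebsch graph is the folded 5-cube, and its 5-cycle 1-4-6-14-16-1, in which each of the five
-- directions of the cube occurs once, is turned into its own reversal by ten such replacements
-- (sorting the directions 12345 into 54321).  So as many edges of this 5-cycle are traversed
-- forwards as backwards, although their number is odd.
module Submission where

open import Defs
open import Data.Fin using (Fin; #_)
open import Data.Fin.Properties using (_≟_)
open import Data.List.Base using (List; []; _∷_; _++_; filter; length; reverse; take)
open import Data.List.Membership.Propositional using (_∈_)
open import Data.List.Properties using (filter-accept; filter-reject; filter-≐; ∷-injectiveˡ; ∷-injectiveʳ)
open import Data.List.Relation.Unary.Any using (here; there)
open import Data.Nat.Base using (ℕ; zero; suc; _+_; _*_; _≤_; z≤n; s≤s; s≤s⁻¹)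
open import Data.Nat.Properties using (≤-trans; n≤1+n; +-assoc; +-identityʳ; even≢odd)
open import Data.Nat.Tactic.RingSolver using (solve-∀)
open import Data.Product.Base using (_×_; _,_; ∃-syntax; proj₁; proj₂)
open import Data.Sum.Base using (_⊎_; inj₁; inj₂; swap)
open import Function.Base using (_∘_)
open import Function.Bundles using (Equivalence)
open import Relation.Binary.Construct.Closure.ReflexiveTransitive using (Star; fold)
open import Relation.Binary.Construct.Closure.ReflexiveTransitive.Properties using (module StarReasoning)
open import Relation.Binary.PropositionalEquality
  using (_≡_; _≢_; refl; sym; trans; cong; cong₂; ≢-sym; module ≡-Reasoning)
open import Relation.Nullary using (Dec; ¬_; yes; no; contradiction)
open import Relation.Nullary.Decidable using (True; toWitness; map′; ¬?; _×-dec_; _⊎-dec_)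

-- Alternation of two letters as inequalities between letter counts in prefixes

module _ {n : ℕ} where

  occ : Fin n → List (Fin n) → ℕ
  occ x w = length (filter (_≟ x) w)

  occ-≡ : ∀ x w → occ x (x ∷ w) ≡ suc (occ x w)
  occ-≡ x w = cong length (filter-accept (_≟ x) {xs = w} refl)

  occ-≢ : ∀ {x z} w → z ≢ x → occ x (z ∷ w) ≡ occ x w
  occ-≢ {x} w z≢x = cong length (filter-reject (_≟ x) {xs = w} z≢x)

  -- For `x ≢ y` this characterises a restricted word of the form `xyxy⋯`. Unlike equations between
  -- restricted words, inequalities for different pairs of letters can be chained by transitivity,
  -- as `chord` does.
  Leads : Fin n → Fin n → List (Fin n) → Set
  Leads x y w = ∀ k → occ y (take k w) ≤ occ x (take k w)
                    × occ x (take k w) ≤ suc (occ y (take k w))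

  module _ {x y : Fin n} (x≢y : x ≢ y) where

    leads-[] : Leads x y []
    leads-[] zero    = z≤n , z≤n
    leads-[] (suc k) = z≤n , z≤n

    -- Dropping the first `x` lowers the count of `x` by one, which turns y ≤ x ≤ 1 + y into x ≤ y ≤
    -- 1 + x: the letters exchange roles.
    leads-head⁻ : ∀ {w} → Leads x y (x ∷ w) → Leads y x w
    leads-head⁻ {w} l k with l (suc k)
    ... | y≤x , x≤1+y rewrite occ-≡ x (take k w) | occ-≢ (take k w) x≢y = s≤s⁻¹ x≤1+y , y≤x

    leads-head⁺ : ∀ {w} → Leads y x w → Leads x y (x ∷ w)
    leads-head⁺ l zero = z≤n , z≤n
    leads-head⁺ {w} l (suc k) rewrite occ-≡ x (take k w) | occ-≢ (take k w) x≢y =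
      proj₂ (l k) , s≤s (proj₁ (l k))

    ¬leads-head : ∀ {w} → ¬ Leads x y (y ∷ w)
    ¬leads-head l with l 1
    ... | y≤x , _ rewrite occ-≡ y [] | occ-≢ [] (≢-sym x≢y) = contradiction y≤x λ ()

    leads-skip⁻ : ∀ {z w} → z ≢ x → z ≢ y → Leads x y (z ∷ w) → Leads x y w
    leads-skip⁻ {w = w} z≢x z≢y l k with l (suc k)
    ... | p rewrite occ-≢ (take k w) z≢x | occ-≢ (take k w) z≢y = p

    leads-skip⁺ : ∀ {z w} → z ≢ x → z ≢ y → Leads x y w → Leads x y (z ∷ w)
    leads-skip⁺ z≢x z≢y l zero = z≤n , z≤n
    leads-skip⁺ {w = w} z≢x z≢y l (suc k)
      rewrite occ-≢ (take k w) z≢x | occ-≢ (take k w) z≢y = l k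

  restrict-comm : ∀ (x y : Fin n) w → restrict x y w ≡ restrict y x w
  restrict-comm x y =
    filter-≐ (λ z → (z ≟ x) ⊎-dec (z ≟ y)) (λ z → (z ≟ y) ⊎-dec (z ≟ x)) (swap , swap)

  leads⇒alternating : ∀ {x y : Fin n} → x ≢ y → ∀ w → Leads x y w →
                      ∃[ k ] restrict x y w ≡ alternating x y k
  leads⇒alternating x≢y [] l = 0 , refl
  leads⇒alternating {x} {y} x≢y (z ∷ w) l with z ≟ x | z ≟ y
  ... | yes refl | _ =
    let k , eq = leads⇒alternating (≢-sym x≢y) w (leads-head⁻ x≢y l)
    in suc k , cong (x ∷_) (trans (restrict-comm x y w) eq)
  ... | no _ | yes refl = contradiction l (¬leads-head x≢y)
  ... | no z≢x | no z≢y = leads⇒alternating x≢y w (leads-skip⁻ x≢y z≢x z≢y l)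

  alternating⇒leads : ∀ {x y : Fin n} → x ≢ y → ∀ w k → restrict x y w ≡ alternating x y k → Leads x y w
  alternating⇒leads x≢y [] k eq = leads-[] x≢y
  alternating⇒leads {x} {y} x≢y (z ∷ w) k eq with z ≟ x | z ≟ y
  alternating⇒leads {x} {y} x≢y (z ∷ w) (suc k) eq | yes refl | _ =
    leads-head⁺ x≢y (alternating⇒leads (≢-sym x≢y) w k
      (trans (restrict-comm y x w) (∷-injectiveʳ eq)))
  alternating⇒leads x≢y (z ∷ w) (suc k) eq | no z≢x | yes refl =
    contradiction (∷-injectiveˡ eq) z≢x
  ... | no z≢x | no z≢y = leads-skip⁺ x≢y z≢x z≢y (alternating⇒leads x≢y w k eq)

  alternate⇒leads : ∀ {x y} → x ≢ y → ∀ w → Alternate x y w → Leads x y w ⊎ Leads y x w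
  alternate⇒leads x≢y w (k , inj₁ eq) = inj₁ (alternating⇒leads x≢y w k eq)
  alternate⇒leads {x} {y} x≢y w (k , inj₂ eq) =
    inj₂ (alternating⇒leads (≢-sym x≢y) w k (trans (restrict-comm y x w) eq))

  -- A 0/1 indicator in `ℕ`, so that the forward edges of a walk can be counted by addition.
  before : Fin n → Fin n → List (Fin n) → ℕ
  before x y [] = 0
  before x y (z ∷ w) with z ≟ x | z ≟ y
  ... | yes _ | _     = 1
  ... | no _  | yes _ = 0
  ... | no _  | no _  = before x y w

  -- The occurrence of `x` rules out a word with neither letter, where `Leads` holds but both
  -- indicators are 0.
  leads⇒before : ∀ {x y w} → x ≢ y → x ∈ w → Leads x y w →
                 before x y w ≡ 1 × before y x w ≡ 0
  leads⇒before {x} {y} {z ∷ w} x≢y x∈zw l with z ≟ x | z ≟ y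
  ... | yes refl | yes refl = contradiction refl x≢y
  ... | yes refl | no _ = refl , refl
  ... | no _ | yes refl = contradiction l (¬leads-head x≢y)
  leads⇒before x≢y (here refl) l | no z≢x | no _ = contradiction refl z≢x
  leads⇒before x≢y (there x∈w) l | no z≢x | no z≢y =
    leads⇒before x≢y x∈w (leads-skip⁻ x≢y z≢x z≢y l)

-- Walks and the replacement of a middle vertex

forward : {A : Set} → (A → A → ℕ) → List A → ℕ
forward f (x ∷ y ∷ xs) = f x y + forward f (y ∷ xs)
forward f _            = 0

forward-swap : ∀ {A : Set} (f : A → A → ℕ) {a b c d} → f a b + f b c ≡ f a d + f d c →
               ∀ us vs → forward f (us ++ a ∷ b ∷ c ∷ vs) ≡ forward f (us ++ a ∷ d ∷ c ∷ vs)
forward-swap f {a} {b} {c} {d} eq [] vs = begin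
  f a b + (f b c + r) ≡⟨ +-assoc (f a b) _ r ⟨
  (f a b + f b c) + r ≡⟨ cong (_+ r) eq ⟩
  (f a d + f d c) + r ≡⟨ +-assoc (f a d) _ r ⟩
  f a d + (f d c + r) ∎
  where
  open ≡-Reasoning
  r : ℕ
  r = forward f (c ∷ vs)
-- `forward` unfolds only when two vertices are visible; after a one-vertex prefix the second one is
-- `a`.
forward-swap f {a} eq (u ∷ [])      vs = cong (f u a +_) (forward-swap f eq [] vs)
forward-swap f     eq (u ∷ u′ ∷ us) vs = cong (f u u′ +_) (forward-swap f eq (u′ ∷ us) vs)

module _ (G : Graph) where
  open Graph G

  record ChordlessSquare (a b c d : Vertex) : Set where
    constructor square
    field
      ab : Edge a b
      bc : Edge b c
      cd : Edge c d
      da : Edge d a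
      a≢c : a ≢ c
      b≢d : b ≢ d
      ¬ac : ¬ Edge a c
      ¬bd : ¬ Edge b d

  data _⇝_ : List Vertex → List Vertex → Set where
    replace : ∀ us {a b c d vs} → ChordlessSquare a b c d →
              (us ++ a ∷ b ∷ c ∷ vs) ⇝ (us ++ a ∷ d ∷ c ∷ vs)

-- The orientation of a graph induced by a representing word

module Representation (G : Graph) (w : List (Graph.Vertex G)) (rep : Represents G w) where
  open Graph G hiding (sym)

  edge⇒≢ : ∀ {x y} → Edge x y → x ≢ y
  edge⇒≢ e refl = irrefl _ e

  f : Vertex → Vertex → ℕ
  f x y = before x y w

  data Arc (x y : Vertex) : Set where
    arc : Leads x y w → f x y ≡ 1 → f y x ≡ 0 → Arc x y

  leads⇒arc : ∀ {x y} → x ≢ y → Leads x y w → Arc x y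
  leads⇒arc {x} x≢y l = let p , q = leads⇒before x≢y (proj₁ rep x) l in arc l p q

  orient : ∀ {x y} → Edge x y → Arc x y ⊎ Arc y x
  orient {x} {y} e with alternate⇒leads (edge⇒≢ e) w (Equivalence.from (proj₂ rep x y (edge⇒≢ e)) e)
  ... | inj₁ l = inj₁ (leads⇒arc (edge⇒≢ e) l)
  ... | inj₂ l = inj₂ (leads⇒arc (edge⇒≢ e ∘ sym) l)

  f-edge : ∀ {x y} → Edge x y → f x y + f y x ≡ 1
  f-edge e with orient e
  ... | inj₁ (arc _ p q) = cong₂ _+_ p q
  ... | inj₂ (arc _ p q) = cong₂ _+_ q p

  -- In every prefix the counts satisfy c ≤ b ≤ a ≤ 1 + d ≤ 1 + c. The bound a ≤ 1 + d holds for
  -- either direction of the edge between `a` and `d`.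
  chord : ∀ {a b c d} → a ≢ c → Arc a b → Arc b c → Arc c d → Arc a d ⊎ Arc d a → Edge a c
  chord {a} {b} {c} {d} a≢c (arc ab _ _) (arc bc _ _) (arc cd _ _) ad =
    Equivalence.to (proj₂ rep a c a≢c)
      (let k , eq = leads⇒alternating a≢c w ac in k , inj₁ eq)
    where
    a≤1+d : Arc a d ⊎ Arc d a → ∀ k → occ a (take k w) ≤ suc (occ d (take k w))
    a≤1+d (inj₁ (arc l _ _)) k = proj₂ (l k)
    a≤1+d (inj₂ (arc l _ _)) k = ≤-trans (proj₁ (l k)) (n≤1+n _)
    ac : Leads a c w
    ac k = ≤-trans (proj₁ (bc k)) (proj₁ (ab k))
         , ≤-trans (a≤1+d ad k) (s≤s (proj₁ (cd k)))

  f-square : ∀ {a b c d} → ChordlessSquare G a b c d → f a b + f b c ≡ f a d + f d c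
  f-square {a} {b} {c} {d} (square eab ebc ecd eda a≢c b≢d ¬ac ¬bd) =
    balance (orient eab) (orient ebc) (orient ecd) (orient eda)
    where
    ¬ca : ¬ Edge c a
    ¬ca = ¬ac ∘ Graph.sym G
    ¬db : ¬ Edge d b
    ¬db = ¬bd ∘ Graph.sym G
    values : ∀ {i j k l} → f a b ≡ i → f b c ≡ j → f a d ≡ k → f d c ≡ l → i + j ≡ k + l →
             f a b + f b c ≡ f a d + f d c
    values p q r s eq = trans (cong₂ _+_ p q) (trans eq (sym (cong₂ _+_ r s)))
    -- Of the 16 orientations, the six with two edges in each direction around the square satisfy
    -- the equation, because `f c d` and `f d a` are the complements of `f d c` and `f a d`. The
    -- other ten contain a directed path of three edges, whose chord is excluded.
    balance : Arc a b ⊎ Arc b a → Arc b c ⊎ Arc c b → Arc c d ⊎ Arc d c → Arc d a ⊎ Arc a d →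
              f a b + f b c ≡ f a d + f d c
    balance (inj₁ ab) (inj₁ bc) (inj₁ cd) (inj₁ da) = contradiction (chord a≢c ab bc cd (inj₂ da)) ¬ac
    balance (inj₁ ab) (inj₁ bc) (inj₁ cd) (inj₂ ad) = contradiction (chord a≢c ab bc cd (inj₁ ad)) ¬ac
    balance (inj₁ ab) (inj₁ bc) (inj₂ dc) (inj₁ da) = contradiction (chord (≢-sym b≢d) da ab bc (inj₁ dc)) ¬db
    balance (inj₁ (arc _ ab _)) (inj₁ (arc _ bc _)) (inj₂ (arc _ dc _)) (inj₂ (arc _ ad _)) = values ab bc ad dc refl
    balance (inj₁ ab) (inj₂ cb) (inj₁ cd) (inj₁ da) = contradiction (chord (≢-sym a≢c) cd da ab (inj₁ cb)) ¬ca
    balance (inj₁ (arc _ ab _)) (inj₂ (arc _ _ bc)) (inj₁ (arc _ _ dc)) (inj₂ (arc _ ad _)) = values ab bc ad dc refl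
    balance (inj₁ (arc _ ab _)) (inj₂ (arc _ _ bc)) (inj₂ (arc _ dc _)) (inj₁ (arc _ _ ad)) = values ab bc ad dc refl
    balance (inj₁ ab) (inj₂ cb) (inj₂ dc) (inj₂ ad) = contradiction (chord a≢c ad dc cb (inj₁ ab)) ¬ac
    balance (inj₂ ba) (inj₁ bc) (inj₁ cd) (inj₁ da) = contradiction (chord b≢d bc cd da (inj₁ ba)) ¬bd
    balance (inj₂ (arc _ _ ab)) (inj₁ (arc _ bc _)) (inj₁ (arc _ _ dc)) (inj₂ (arc _ ad _)) = values ab bc ad dc refl
    balance (inj₂ (arc _ _ ab)) (inj₁ (arc _ bc _)) (inj₂ (arc _ dc _)) (inj₁ (arc _ _ ad)) = values ab bc ad dc refl
    balance (inj₂ ba) (inj₁ bc) (inj₂ dc) (inj₂ ad) = contradiction (chord b≢d ba ad dc (inj₁ bc)) ¬bd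
    balance (inj₂ (arc _ _ ab)) (inj₂ (arc _ _ bc)) (inj₁ (arc _ _ dc)) (inj₁ (arc _ _ ad)) = values ab bc ad dc refl
    balance (inj₂ ba) (inj₂ cb) (inj₁ cd) (inj₂ ad) = contradiction (chord (≢-sym a≢c) cb ba ad (inj₁ cd)) ¬ca
    balance (inj₂ ba) (inj₂ cb) (inj₂ dc) (inj₁ da) = contradiction (chord (≢-sym b≢d) dc cb ba (inj₁ da)) ¬db
    balance (inj₂ ba) (inj₂ cb) (inj₂ dc) (inj₂ ad) = contradiction (chord (≢-sym b≢d) dc cb ba (inj₂ ad)) ¬db

  forward-⇝ : ∀ {p q} → _⇝_ G p q → forward f p ≡ forward f q
  forward-⇝ (replace us {vs = vs} sq) = forward-swap f (f-square sq) us vs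

  forward-⇝* : ∀ {p q} → Star (_⇝_ G) p q → forward f p ≡ forward f q
  forward-⇝* = fold (λ p q → forward f p ≡ forward f q) (λ st → trans (forward-⇝ st)) refl

-- The pentagon in the Clebsch graph and its reversal

-- vᵢ is the vertex with label i.
v1 v2 v3 v4 v6 v7 v9 v11 v14 v15 v16 : Fin 16
v1  = # 0
v2  = # 1
v3  = # 2
v4  = # 3
v6  = # 5
v7  = # 6
v9  = # 8
v11 = # 10
v14 = # 13
v15 = # 14
v16 = # 15

pentagon : List (Fin 16)
pentagon = v1 ∷ v4 ∷ v6 ∷ v14 ∷ v16 ∷ v1 ∷ []

chordlessSquare? : ∀ a b c d → Dec (ChordlessSquare clebsch a b c d)
chordlessSquare? a b c d = map′
  (λ (ab , bc , cd , da , a≢c , b≢d , ¬ac , ¬bd) → square ab bc cd da a≢c b≢d ¬ac ¬bd)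
  (λ (square ab bc cd da a≢c b≢d ¬ac ¬bd) → ab , bc , cd , da , a≢c , b≢d , ¬ac , ¬bd)
  (clebschEdge? a b ×-dec clebschEdge? b c ×-dec clebschEdge? c d ×-dec clebschEdge? d a
    ×-dec ¬? (a ≟ c) ×-dec ¬? (b ≟ d) ×-dec ¬? (clebschEdge? a c) ×-dec ¬? (clebschEdge? b d))

pentagon⇝*reverse : Star (_⇝_ clebsch) pentagon (reverse pentagon)
pentagon⇝*reverse = begin
  -- This is a bubble sort of the directions: four replacements carry the first direction to the
  -- end, three carry the second behind the rest, two the third, and the last one exchanges the
  -- remaining pair.
  v1 ∷ v4 ∷ v6 ∷ v14 ∷ v16 ∷ v1 ∷ []  ⟶⟨ at [] ⟩
  v1 ∷ v7 ∷ v6 ∷ v14 ∷ v16 ∷ v1 ∷ []  ⟶⟨ at (v1 ∷ []) ⟩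
  v1 ∷ v7 ∷ v15 ∷ v14 ∷ v16 ∷ v1 ∷ [] ⟶⟨ at (v1 ∷ v7 ∷ []) ⟩
  v1 ∷ v7 ∷ v15 ∷ v2 ∷ v16 ∷ v1 ∷ []  ⟶⟨ at (v1 ∷ v7 ∷ v15 ∷ []) ⟩
  v1 ∷ v7 ∷ v15 ∷ v2 ∷ v4 ∷ v1 ∷ []   ⟶⟨ at [] ⟩
  v1 ∷ v9 ∷ v15 ∷ v2 ∷ v4 ∷ v1 ∷ []   ⟶⟨ at (v1 ∷ []) ⟩
  v1 ∷ v9 ∷ v3 ∷ v2 ∷ v4 ∷ v1 ∷ []    ⟶⟨ at (v1 ∷ v9 ∷ []) ⟩
  v1 ∷ v9 ∷ v3 ∷ v6 ∷ v4 ∷ v1 ∷ []    ⟶⟨ at [] ⟩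
  v1 ∷ v11 ∷ v3 ∷ v6 ∷ v4 ∷ v1 ∷ []   ⟶⟨ at (v1 ∷ []) ⟩
  v1 ∷ v11 ∷ v14 ∷ v6 ∷ v4 ∷ v1 ∷ []  ⟶⟨ at [] ⟩
  v1 ∷ v16 ∷ v14 ∷ v6 ∷ v4 ∷ v1 ∷ [] ∎
  where
  open StarReasoning (_⇝_ clebsch)
  at : ∀ us {a b c d vs} {_ : True (chordlessSquare? a b c d)} →
       _⇝_ clebsch (us ++ a ∷ b ∷ c ∷ vs) (us ++ a ∷ d ∷ c ∷ vs)
  at us {_} {_} {_} {_} {_} {sq} = replace us (toWitness sq)

module _ (w : List (Fin 16)) (rep : Represents clebsch w) where
  open Representation clebsch w rep

  -- Each of the five edges is traversed forwards by exactly one of the two walks.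
  forward-odd : forward f pentagon + forward f (reverse pentagon) ≡ 5
  forward-odd = begin
    f v1 v4 + (f v4 v6 + (f v6 v14 + (f v14 v16 + (f v16 v1 + 0)))) +
    (f v1 v16 + (f v16 v14 + (f v14 v6 + (f v6 v4 + (f v4 v1 + 0)))))
      ≡⟨ pair-up (f v1 v4) (f v4 v6) (f v6 v14) (f v14 v16) (f v16 v1)
                (f v1 v16) (f v16 v14) (f v14 v6) (f v6 v4) (f v4 v1) ⟩
    (f v1 v4 + f v4 v1) + ((f v4 v6 + f v6 v4) + ((f v6 v14 + f v14 v6) +
      ((f v14 v16 + f v16 v14) + (f v16 v1 + f v1 v16))))
      ≡⟨ cong₂ _+_ (f-pair v1 v4) (cong₂ _+_ (f-pair v4 v6) (cong₂ _+_ (f-pair v6 v14)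
           (cong₂ _+_ (f-pair v14 v16) (f-pair v16 v1)))) ⟩
    5 ∎
    where
    open ≡-Reasoning
    f-pair : ∀ x y → {True (clebschEdge? x y)} → f x y + f y x ≡ 1
    f-pair x y {e} = f-edge (toWitness e)
    -- The reversed walk meets the edges in the opposite order, hence the descending primed letters;
    -- each `+ 0` is the value of `forward` at the last vertex.
    pair-up : ∀ a b c d e e′ d′ c′ b′ a′ →
              a + (b + (c + (d + (e + 0)))) + (e′ + (d′ + (c′ + (b′ + (a′ + 0))))) ≡
              (a + a′) + ((b + b′) + ((c + c′) + ((d + d′) + (e + e′))))
    pair-up = solve-∀

mainTheorem3 : ¬ WordRepresentable clebsch
-- The argument 2 encodes the odd number 5 as 1 + 2 * 2.
mainTheorem3 (w , rep) = even≢odd k 2 (begin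
  2 * k     ≡⟨ cong (k +_) (+-identityʳ k) ⟩
  k + k     ≡⟨ cong (k +_) (forward-⇝* pentagon⇝*reverse) ⟩
  k + _     ≡⟨ forward-odd w rep ⟩
  5         ∎)
  where
  open ≡-Reasoning
  open Representation clebsch w rep using (f; forward-⇝*)
  k : ℕ
  k = forward f pentagon
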